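{- If $G$ and $H$ are nontrivial connected graphs, then $pc_{1,2}(G\vee H)\leq 3$.
   Context: All graphs are finite, undirected and simple; a graph is nontrivial if it has at least two vertices. The join $G\vee H$ of two (vertex-disjoint) graphs has vertex set $V(G)\cup V(H)$ and edge set $E(G)\cup E(H)\cup\{uv: u\in V(G),\ v\in V(H)\}$. An edge-coloring of a graph is an arbitrary map from its edge set to the natural numbers (adjacent edges may share a color). In an edge-colored graph, a path $P$ is a distance $2$-proper path if no two edges of $P$ of the same color appear with fewer than $2$ edges in between on $P$. For a connected graph $F$, $pc_{1,2}(F)$ is the minimum number of colors in an edge-coloring of $F$ such that every pair of distinct vertices of $F$ is connected by at least one distance $2$-proper path. -}

module Defs where

open import Data.Fin.Base as Fin using (Fin; toℕ)
open import Data.Fin.Properties using (+↔⊎)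
open import Data.List.Base using (List; []; _∷_; length; lookup)
open import Data.List.Membership.Propositional using (_∈_)
open import Data.List.Relation.Unary.Unique.Propositional using (Unique)
open import Data.Nat.Base using (ℕ; suc; _+_; _∸_; _≤_; _<_)
open import Data.Product.Base using (Σ-syntax; ∃-syntax; _×_)
open import Data.Sum.Base using (_⊎_; inj₁; inj₂)
open import Data.Sum.Function.Propositional using (_⊎-↔_)
open import Data.Unit.Base using (⊤; tt)
open import Function.Bundles using (_↔_; _⇔_)
open import Function.Construct.Composition using (_↔-∘_)
open import Function.Construct.Symmetry using (↔-sym)
open import Relation.Binary.Construct.Closure.ReflexiveTransitive
  using (Star; ε; _◅_)
open import Relation.Binary.Definitions using (Decidable; Symmetric)
open import Relation.Binary.PropositionalEquality.Core using (_≡_; _≢_)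
open import Relation.Nullary using (¬_; yes)

record Graph : Set₁ where
  field
    V       : Set
    order   : ℕ
    finite  : V ↔ Fin order
    Adj     : V → V → Set
    adj?    : Decidable Adj
    adj-sym : Symmetric Adj
    irrefl  : ∀ v → ¬ Adj v v

open Graph public

Nontrivial : Graph → Set
Nontrivial G = 2 ≤ order G

Walk : (G : Graph) → V G → V G → Set
Walk G = Star (Adj G)

vertices : (G : Graph) {u v : V G} → Walk G u v → List (V G)
vertices G {u} ε       = u ∷ []
vertices G {u} (e ◅ p) = u ∷ vertices G p

IsPath : (G : Graph) {u v : V G} → Walk G u v → Set
IsPath G p = Unique (vertices G p)

Connected : Graph → Set
Connected G = ∀ u v → Σ[ p ∈ Walk G u v ] IsPath G p

JoinAdj : (G H : Graph) → V G ⊎ V H → V G ⊎ V H → Set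
JoinAdj G H (inj₁ u) (inj₁ v) = Adj G u v
JoinAdj G H (inj₁ u) (inj₂ v) = ⊤
JoinAdj G H (inj₂ u) (inj₁ v) = ⊤
JoinAdj G H (inj₂ u) (inj₂ v) = Adj H u v

infixr 6 _∨ᴳ_

_∨ᴳ_ : Graph → Graph → Graph
G ∨ᴳ H = record
  { V       = V G ⊎ V H
  ; order   = order G + order H
  ; finite  = ↔-sym +↔⊎ ↔-∘ (finite G ⊎-↔ finite H)
  ; Adj     = JoinAdj G H
  ; adj?    = dec
  ; adj-sym = λ {u} {v} → symm u v
  ; irrefl  = irr
  }
  where
  dec : Decidable (JoinAdj G H)
  dec (inj₁ u) (inj₁ v) = adj? G u v
  dec (inj₁ u) (inj₂ v) = yes tt
  dec (inj₂ u) (inj₁ v) = yes tt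
  dec (inj₂ u) (inj₂ v) = adj? H u v

  symm : ∀ u v → JoinAdj G H u v → JoinAdj G H v u
  symm (inj₁ u) (inj₁ v) e = adj-sym G e
  symm (inj₁ u) (inj₂ v) e = tt
  symm (inj₂ u) (inj₁ v) e = tt
  symm (inj₂ u) (inj₂ v) e = adj-sym H e

  irr : ∀ v → ¬ JoinAdj G H v v
  irr (inj₁ v) = irrefl G v
  irr (inj₂ v) = irrefl H v

-- Adj need not be proof-irrelevant.  Since the two adjacency proofs in
-- `unoriented` are arbitrary, the colour depends only on the unordered pair
-- {u , v}, so this is exactly a map from the edge set to ℕ.
record EdgeColouring (G : Graph) : Set where
  field
    colour     : ∀ {u v} → Adj G u v → ℕ
    unoriented : ∀ {u v} (e : Adj G u v) (e′ : Adj G v u) →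
                 colour e ≡ colour e′

open EdgeColouring public

module _ {G : Graph} (c : EdgeColouring G) where

  colours : ∀ {u v} → Walk G u v → List ℕ
  colours ε       = []
  colours (e ◅ p) = colour c e ∷ colours p

  -- For positions i < j there are j ∸ suc i edges strictly in between.
  Distance2Proper : ∀ {u v} → Walk G u v → Set
  Distance2Proper p =
    ∀ (i j : Fin (length (colours p))) → i Fin.< j →
    toℕ j ∸ suc (toℕ i) < 2 →
    lookup (colours p) i ≢ lookup (colours p) j

  Distance2ProperConnected : Set
  Distance2ProperConnected =
    ∀ u v → u ≢ v → Σ[ p ∈ Walk G u v ] (IsPath G p × Distance2Proper p)

  Used : ℕ → Set
  Used x = ∃[ u ] ∃[ v ] Σ[ e ∈ Adj G u v ] colour c e ≡ x

  -- The set of colours occurring on edges has exactly k elements.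
  NumColours : ℕ → Set
  NumColours k =
    Σ[ xs ∈ List ℕ ] (Unique xs × (∀ x → x ∈ xs ⇔ Used x) × length xs ≡ k)

-- IsPc₁,₂ F k says pc₁,₂(F) = k.  It determines k uniquely, but is a relation
-- rather than a function because the existence of the minimum needs a proof.
IsPc₁,₂ : Graph → ℕ → Set
IsPc₁,₂ F k =
  (Σ[ c ∈ EdgeColouring F ] (Distance2ProperConnected c × NumColours c k)) ×
  (∀ (c : EdgeColouring F) j →
     Distance2ProperConnected c → NumColours c j → k ≤ j)

{-# OPTIONS --safe #-}

-- Let S be a maximal independent set of G.  As G has no isolated vertex, every
-- vertex has a neighbour on the other side of the partition V(G) = S ∪ Sᶜ.
-- Colour the edges inside G or inside H with 0, those between S and H with 1
-- and those between Sᶜ and H with 2.  Two vertices of G on different sides are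
-- joined through any vertex of H (1, 2); two vertices on the same side first
-- move to the other side (0, 2, 1 or 0, 1, 2); two vertices of H are joined
-- through an edge of G between S and Sᶜ (1, 0, 2).
--
-- The value of pc₁,₂ has to be decided as well.  Any three consecutive edges
-- of a distance 2-proper path have distinct colours, so with at most one colour
-- only adjacent vertices are connected, and with two colours only paths with at
-- most two edges occur, which reduces the question to a finite search.
module Submission where

open import Defs
open import Data.Bool.Base using (Bool; true; false; not; _∨_; if_then_else_)
import Data.Bool.Properties as Bool
open import Data.Empty using (⊥-elim)
open import Data.Fin.Base as Fin using (Fin; zero; suc; combine; remQuot)
import Data.Fin.Properties as Fin
open import Data.Fin.Subset using (Subset)
open import Data.Fin.Subset.Properties using (anySubset?)
open import Data.List.Base as List using (List; []; _∷_; length; filter; upTo; map; allFin)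
open import Data.List.Membership.Propositional using (_∈_; find)
open import Data.List.Membership.Propositional.Properties
  using (∈-filter⁺; ∈-filter⁻; ∈-upTo⁺; ∈-map⁺; ∈-allFin; ∈-lookup)
open import Data.List.Properties using (length-filter; length-upTo)
open import Data.List.Relation.Unary.All as All using ([]; _∷_)
open import Data.List.Relation.Unary.AllPairs using ([]; _∷_)
open import Data.List.Relation.Unary.Any as Any using (here; there)
open import Data.List.Relation.Unary.Unique.Propositional using (Unique)
open import Data.List.Relation.Unary.Unique.Propositional.Properties
  using (filter⁺; upTo⁺)
open import Data.Nat.Base using (ℕ; zero; suc; _*_; _≤_; _<_; z≤n; s≤s)
open import Data.Nat.Properties as ℕ using (≤-trans; ≤-antisym; ≤-reflexive)
open import Data.Product.Base using (∃; ∃-syntax; Σ-syntax; _×_; _,_; proj₁; proj₂)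
open import Data.Sum.Base using (_⊎_; inj₁; inj₂)
open import Data.Sum.Properties using (inj₁-injective)
open import Data.Unit.Base using (tt)
open import Data.Vec.Base using (lookup; tabulate)
open import Data.Vec.Properties using (lookup∘tabulate)
open import Function.Base using (_∘_)
open import Function.Bundles using (Inverse; _⇔_; mk⇔; module Equivalence)
open import Relation.Binary.Construct.Closure.ReflexiveTransitive using (ε; _◅_)
open import Relation.Binary.Definitions using (DecidableEquality)
open import Relation.Binary.PropositionalEquality
open import Relation.Nullary
open import Relation.Nullary.Decidable
  using (map′; _×-dec_; _⊎-dec_; ¬?; dec-true; dec-false)
import Relation.Unary as U

-- Finiteness of the vertex set

module _ (F : Graph) where

  index : V F → Fin (order F)
  index = Inverse.to (finite F)

  vertex : Fin (order F) → V F
  vertex = Inverse.from (finite F)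

  vertex∘index : ∀ v → vertex (index v) ≡ v
  vertex∘index v = Inverse.inverseʳ (finite F) refl

  index∘vertex : ∀ i → index (vertex i) ≡ i
  index∘vertex i = Inverse.inverseˡ (finite F) refl

  _≟ⱽ_ : DecidableEquality (V F)
  u ≟ⱽ v = map′ (λ eq → trans (sym (vertex∘index u))
                              (trans (cong vertex eq) (vertex∘index v)))
                (cong index)
                (index u Fin.≟ index v)

  all-vertices? : {P : V F → Set} → U.Decidable P → Dec (∀ v → P v)
  all-vertices? {P} P? = map′ (λ h v → subst P (vertex∘index v) (h (index v)))
                              (λ h i → h (vertex i))
                              (Fin.all? (P? ∘ vertex))

  any-vertex? : {P : V F → Set} → U.Decidable P → Dec (∃ P)
  any-vertex? {P} P? = map′ (λ (i , p) → vertex i , p)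
                            (λ (v , p) → index v , subst P (sym (vertex∘index v)) p)
                            (Fin.any? (P? ∘ vertex))

  a-vertex : Nontrivial F → V F
  a-vertex nt = vertex (Fin.fromℕ< nt)

  -- Of two distinct vertices at most one equals `v`. In `other` the order is generalised to a
  -- variable `n`, so that `2 ≤ n` can be matched.
  another-vertex : Nontrivial F → ∀ v → ∃[ w ] v ≢ w
  another-vertex nt v = other nt vertex λ {i} {j} eq →
      trans (sym (index∘vertex i)) (trans (cong index eq) (index∘vertex j))
    where
    other : ∀ {n} → 2 ≤ n → (f : Fin n → V F) → (∀ {i j} → f i ≡ f j → i ≡ j) →
            ∃[ w ] v ≢ w
    other (s≤s (s≤s z≤n)) f inj with v ≟ⱽ f zero
    ... | no  v≢  = f zero , v≢
    ... | yes v≡ = f (suc zero) , λ v≡′ → Fin.0≢1+n (inj (trans (sym v≡) v≡′))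

  neighbour : Nontrivial F → Connected F → ∀ v → ∃[ w ] Adj F v w
  neighbour nt conn v with another-vertex nt v
  ... | w , v≢w with conn v w
  ... | ε           , _ = ⊥-elim (v≢w refl)
  ... | _◅_ {j = x} e _ , _ = x , e

  Adj⇒≢ : ∀ {u v} → Adj F u v → u ≢ v
  Adj⇒≢ e refl = irrefl F _ e

-- Edge colourings

unique⇒lookup-≢ : ∀ {A : Set} {xs : List A} → Unique xs →
                  ∀ {i j} → i Fin.< j → List.lookup xs i ≢ List.lookup xs j
unique⇒lookup-≢ (x∉ ∷ _) {zero}  {suc j} _         = All.lookup x∉ (∈-lookup j)
unique⇒lookup-≢ (_ ∷ u)  {suc i} {suc j} (s≤s i<j) = unique⇒lookup-≢ u i<j

symmetric-colouring : (F : Graph) (χ : V F → V F → ℕ) → (∀ u v → χ u v ≡ χ v u) →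
                      EdgeColouring F
symmetric-colouring F χ χ-sym = record
  { colour     = λ {u} {v} _ → χ u v
  ; unoriented = λ {u} {v} _ _ → χ-sym u v
  }

module _ {F : Graph} (c : EdgeColouring F) where

  -- Both colours agree with that of the reversed edge.
  colour-irrelevant : ∀ {u v} (e e′ : Adj F u v) → colour c e ≡ colour c e′
  colour-irrelevant e e′ =
    trans (unoriented c e (adj-sym F e)) (unoriented c (adj-sym F e) e′)

  used? : U.Decidable (Used c)
  used? x = any-vertex? F λ u → any-vertex? F λ v → edge? u v
    where
    edge? : ∀ u v → Dec (Σ[ e ∈ Adj F u v ] colour c e ≡ x)
    edge? u v with adj? F u v
    ... | no ¬e = no (¬e ∘ proj₁)
    -- Testing one adjacency proof is enough, since all of them receive the same colour.
    ... | yes e = map′ (e ,_) (λ (e′ , eq) → trans (colour-irrelevant e e′) eq)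
                       (colour c e ℕ.≟ x)

  numColours-bounded : ∀ {n} → (∀ {u v} (e : Adj F u v) → colour c e < n) →
                       ∃[ k ] (NumColours c k × k ≤ n)
  numColours-bounded {n} bound =
    length xs , (xs , filter⁺ used? (upTo⁺ n) , ∈⇔used , refl) ,
    ≤-trans (length-filter used? (upTo n)) (≤-reflexive (length-upTo n))
    where
    xs = filter used? (upTo n)

    ∈⇔used : ∀ x → _
    ∈⇔used x = mk⇔
      (λ x∈xs → proj₂ (∈-filter⁻ used? {xs = upTo n} x∈xs))
      (λ { (u , v , e , refl) → ∈-filter⁺ used? (∈-upTo⁺ (bound e)) (u , v , e , refl) })

  -- Every path built below has at most three edges, and on such paths being rainbow is the same as
  -- being distance 2-proper.
  rainbow⇒distance2Proper : ∀ {u v} (p : Walk F u v) →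
                            Unique (colours c p) → Distance2Proper c p
  rainbow⇒distance2Proper p uniq i j i<j _ = unique⇒lookup-≢ uniq i<j

  Linked : V F → V F → Set
  Linked u v = Σ[ p ∈ Walk F u v ] (IsPath F p × Distance2Proper c p)

  linked₁ : ∀ {u v} → Adj F u v → Linked u v
  linked₁ e = e ◅ ε , (Adj⇒≢ F e ∷ []) ∷ [] ∷ [] ,
              rainbow⇒distance2Proper (e ◅ ε) ([] ∷ [])

  linked₂ : ∀ {u w v} (e : Adj F u w) (f : Adj F w v) → u ≢ v →
            colour c e ≢ colour c f → Linked u v
  linked₂ e f u≢v e≢f =
    e ◅ f ◅ ε ,
    (Adj⇒≢ F e ∷ u≢v ∷ []) ∷ (Adj⇒≢ F f ∷ []) ∷ [] ∷ [] ,
    rainbow⇒distance2Proper (e ◅ f ◅ ε) ((e≢f ∷ []) ∷ [] ∷ [])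

  linked₃ : ∀ {u x y v} (e : Adj F u x) (f : Adj F x y) (g : Adj F y v) →
            u ≢ y → x ≢ v → u ≢ v →
            colour c e ≢ colour c f → colour c f ≢ colour c g →
            colour c e ≢ colour c g → Linked u v
  linked₃ e f g u≢y x≢v u≢v e≢f f≢g e≢g =
    e ◅ f ◅ g ◅ ε ,
    (Adj⇒≢ F e ∷ u≢y ∷ u≢v ∷ []) ∷ (Adj⇒≢ F f ∷ x≢v ∷ []) ∷ (Adj⇒≢ F g ∷ []) ∷ [] ∷ [] ,
    rainbow⇒distance2Proper (e ◅ f ◅ g ◅ ε) ((e≢f ∷ e≢g ∷ []) ∷ (f≢g ∷ []) ∷ [] ∷ [])

-- The colouring `c` is only known to use colours below `n`. Applying the lower bound to `c` itself
-- shows that it uses exactly `n` of them.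
isPc-intro : ∀ {F n} (c : EdgeColouring F) → Distance2ProperConnected c →
             (∀ {u v} (e : Adj F u v) → colour c e < n) →
             (∀ (c′ : EdgeColouring F) j → Distance2ProperConnected c′ →
                NumColours c′ j → n ≤ j) →
             IsPc₁,₂ F n
isPc-intro c conn bound lower with numColours-bounded c bound
... | k , nc , k≤n =
  (c , conn , subst (NumColours c) (≤-antisym k≤n (lower c k conn nc)) nc) , lower

-- Colourings with at most two colours

module _ (F : Graph) where

  Complete : Set
  Complete = ∀ u v → u ≡ v ⊎ Adj F u v

  complete? : Dec Complete
  complete? = all-vertices? F λ u → all-vertices? F λ v → _≟ⱽ_ F u v ⊎-dec adj? F u v

  TwoStep : (V F → V F → Bool) → V F → V F → Set
  TwoStep χ u v = ∃[ w ] (Adj F u w × Adj F w v × χ u w ≢ χ w v)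

  Rainbow : (V F → V F → Bool) → Set
  Rainbow χ = ∀ u v → u ≡ v ⊎ Adj F u v ⊎ TwoStep χ u v

  rainbow? : ∀ χ → Dec (Rainbow χ)
  rainbow? χ = all-vertices? F λ u → all-vertices? F λ v →
    _≟ⱽ_ F u v ⊎-dec adj? F u v ⊎-dec
    any-vertex? F λ w → adj? F u w ×-dec adj? F w v ×-dec ¬? (χ u w Bool.≟ χ w v)

  pair : V F → V F → Fin (order F * order F)
  pair u v = combine (index F u) (index F v)

  -- The disjunction makes every subset of V × V encode a symmetric function.
  decode : Subset (order F * order F) → V F → V F → Bool
  decode S u v = lookup S (pair u v) ∨ lookup S (pair v u)

  encode : (V F → V F → Bool) → Subset (order F * order F)
  encode f = tabulate λ i → let (j , k) = remQuot (order F) i in f (vertex F j) (vertex F k)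

  lookup-encode : ∀ f u v → lookup (encode f) (pair u v) ≡ f u v
  lookup-encode f u v = trans (lookup∘tabulate _ (pair u v))
    (trans (cong (λ (j , k) → f (vertex F j) (vertex F k))
                 (Fin.remQuot-combine (index F u) (index F v)))
           (cong₂ f (vertex∘index F u) (vertex∘index F v)))

  -- Quantifying over subsets of a finite set instead of functions puts the search within reach of
  -- `anySubset?`.
  RainbowColourable : Set
  RainbowColourable = ∃[ S ] Rainbow (decode S)

  rainbowColourable? : Dec RainbowColourable
  rainbowColourable? = anySubset? λ S → rainbow? (decode S)

module _ {F : Graph} (c : EdgeColouring F) (conn : Distance2ProperConnected c) where

  colour∈ : ∀ {u v xs} → (∀ x → x ∈ xs ⇔ Used c x) →
            (e : Adj F u v) → colour c e ∈ xs
  colour∈ used e = Equivalence.from (used _) (_ , _ , e , refl)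

  -- The first two edges of a longer path would share the only colour.
  one-colour⇒complete : NumColours c 1 → Complete F
  one-colour⇒complete (a ∷ [] , _ , used , _) u v with _≟ⱽ_ F u v
  ... | yes u≡v = inj₁ u≡v
  ... | no  u≢v with conn u v u≢v
  ...   | ε         , _     = inj₁ refl
  ...   | e ◅ ε     , _     = inj₂ e
  ...   | e ◅ f ◅ p , _ , d with colour∈ used e | colour∈ used f
  ...     | here eq | here fq =
    ⊥-elim (d zero (suc zero) (s≤s z≤n) (s≤s z≤n) (trans eq (sym fq)))

  two-colours⇒rainbow : NumColours c 2 → RainbowColourable F
  two-colours⇒rainbow (a ∷ b ∷ [] , _ , used , _) = encode F isA , rainbow
    where
    isA : V F → V F → Bool
    isA u v with adj? F u v
    ... | yes e = does (colour c e ℕ.≟ a)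
    -- A default value: `Rainbow` reads the colouring only along edges.
    ... | no  _ = false

    isA-edge : ∀ {u v} (e : Adj F u v) → isA u v ≡ does (colour c e ℕ.≟ a)
    isA-edge {u} {v} e with adj? F u v
    ... | yes e′ = cong (λ x → does (x ℕ.≟ a)) (colour-irrelevant c e′ e)
    ... | no  ¬e = ⊥-elim (¬e e)

    χ : V F → V F → Bool
    χ = decode F (encode F isA)

    -- `decode` takes the disjunction of the bits of an edge and of its reverse. These agree because
    -- `c` is unoriented, so idempotence applies.
    χ-edge : ∀ {u v} (e : Adj F u v) → χ u v ≡ does (colour c e ℕ.≟ a)
    χ-edge {u} {v} e = trans
      (cong₂ _∨_ (trans (lookup-encode F isA u v) (isA-edge e))
                 (trans (lookup-encode F isA v u)
                   (trans (isA-edge (adj-sym F e))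
                     (cong (λ x → does (x ℕ.≟ a)) (unoriented c (adj-sym F e) e)))))
      (Bool.∨-idem _)

    -- A colour other than `a` must be `b`, so comparison with `a` alone tells the two colours
    -- apart.
    separates : ∀ {x y} → x ∈ a ∷ b ∷ [] → y ∈ a ∷ b ∷ [] → x ≢ y →
                does (x ℕ.≟ a) ≢ does (y ℕ.≟ a)
    separates (here x≡a) _ x≢y eq =
      Bool.not-¬ (dec-true (_ ℕ.≟ a) x≡a)
        (trans eq (dec-false (_ ℕ.≟ a) λ y≡a → x≢y (trans x≡a (sym y≡a))))
    separates (there _) (here y≡a) x≢y eq =
      Bool.not-¬ (dec-true (_ ℕ.≟ a) y≡a)
        (trans (sym eq) (dec-false (_ ℕ.≟ a) λ x≡a → x≢y (trans x≡a (sym y≡a))))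
    separates (there (here x≡b)) (there (here y≡b)) x≢y _ = x≢y (trans x≡b (sym y≡b))

    pigeonhole : ∀ {x y z} → x ∈ a ∷ b ∷ [] → y ∈ a ∷ b ∷ [] → z ∈ a ∷ b ∷ [] →
                 x ≢ y → y ≢ z → ¬ x ≢ z
    pigeonhole (here p)         (here q)         _                x≢y _   _   = x≢y (trans p (sym q))
    pigeonhole (here p)         (there (here _)) (here r)         _   _   x≢z = x≢z (trans p (sym r))
    pigeonhole _                (there (here q)) (there (here r)) _   y≢z _   = y≢z (trans q (sym r))
    pigeonhole _                (here q)         (here r)         _   y≢z _   = y≢z (trans q (sym r))
    pigeonhole (there (here p)) (here _)         (there (here r)) _   _   x≢z = x≢z (trans p (sym r))
    pigeonhole (there (here p)) (there (here q)) _                x≢y _   _   = x≢y (trans p (sym q))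

    rainbow : Rainbow F χ
    rainbow u v with _≟ⱽ_ F u v
    ... | yes u≡v = inj₁ u≡v
    ... | no  u≢v with conn u v u≢v
    ...   | ε         , _ = inj₁ refl
    ...   | e ◅ ε     , _ = inj₂ (inj₁ e)
    ...   | e ◅ f ◅ ε , _ , d = inj₂ (inj₂ (_ , e , f , λ eq →
            separates (colour∈ used e) (colour∈ used f)
              (d zero (suc zero) (s≤s z≤n) (s≤s z≤n))
              (trans (sym (χ-edge e)) (trans eq (χ-edge f)))))
    -- Even the first and third edges have just one edge in between, so the three colours would be
    -- pairwise distinct.
    ...   | e ◅ f ◅ g ◅ _ , _ , d = ⊥-elim (pigeonhole
              (colour∈ used e) (colour∈ used f) (colour∈ used g)
              (d zero (suc zero) (s≤s z≤n) (s≤s z≤n))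
              (d (suc zero) (suc (suc zero)) (s≤s (s≤s z≤n)) (s≤s z≤n))
              (d zero (suc (suc zero)) (s≤s z≤n) (s≤s (s≤s z≤n))))

  numColours-positive : ∀ {u v} → Adj F u v → ∀ j → NumColours c j → 1 ≤ j
  numColours-positive _ (suc _) _ = s≤s z≤n
  numColours-positive e zero ([] , _ , used , _) with colour∈ used e
  ... | ()

  numColours≥2 : ∀ {u v} → Adj F u v → ¬ Complete F → ∀ j → NumColours c j → 2 ≤ j
  numColours≥2 e ¬K j nc = ℕ.≤∧≢⇒< (numColours-positive e j nc)
    λ { refl → ¬K (one-colour⇒complete nc) }

  numColours≥3 : ∀ {u v} → Adj F u v → ¬ Complete F → ¬ RainbowColourable F →
                 ∀ j → NumColours c j → 3 ≤ j
  numColours≥3 e ¬K ¬R j nc = ℕ.≤∧≢⇒< (numColours≥2 e ¬K j nc)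
    λ { refl → ¬R (two-colours⇒rainbow nc) }

-- Graphs for which the value is 1 or 2

complete⇒isPc₁ : ∀ {F u v} → Adj F u v → Complete F → IsPc₁,₂ F 1
complete⇒isPc₁ {F} e K = isPc-intro c conn (λ _ → s≤s z≤n)
  (λ c′ j conn′ → numColours-positive c′ conn′ e j)
  where
  c = symmetric-colouring F (λ _ _ → 0) (λ _ _ → refl)

  conn : Distance2ProperConnected c
  conn u v u≢v with K u v
  ... | inj₁ u≡v = ⊥-elim (u≢v u≡v)
  ... | inj₂ f   = linked₁ c f

-- A two-edge path is distance 2-proper as soon as its edges differ in colour, so the bits of
-- `decode F S` serve directly as colours 0 and 1.
rainbow⇒isPc₂ : ∀ {F u v} → Adj F u v → ¬ Complete F → RainbowColourable F → IsPc₁,₂ F 2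
rainbow⇒isPc₂ {F} e ¬K (S , R) = isPc-intro c conn (λ {u} {v} _ → bit<2 (decode F S u v))
  (λ c′ j conn′ → numColours≥2 c′ conn′ e ¬K j)
  where
  bit : Bool → ℕ
  bit b = if b then 1 else 0

  bit<2 : ∀ b → bit b < 2
  bit<2 true  = s≤s (s≤s z≤n)
  bit<2 false = s≤s z≤n

  bit-injective : ∀ {b b′} → bit b ≡ bit b′ → b ≡ b′
  bit-injective {true}  {true}  _ = refl
  bit-injective {false} {false} _ = refl

  c = symmetric-colouring F (λ u v → bit (decode F S u v))
        (λ u v → cong bit (Bool.∨-comm (lookup S (pair F u v)) _))

  conn : Distance2ProperConnected c
  conn u v u≢v with R u v
  ... | inj₁ u≡v                        = ⊥-elim (u≢v u≡v)
  ... | inj₂ (inj₁ f)                   = linked₁ c f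
  ... | inj₂ (inj₂ (w , f , g , χf≢χg)) = linked₂ c f g u≢v (χf≢χg ∘ bit-injective)

-- Maximal independent sets

module _ (G : Graph) where

  -- The list is scanned from its end, and a vertex is kept unless it has a neighbour among those
  -- already kept.
  greedy : List (V G) → List (V G)
  greedy []       = []
  greedy (v ∷ vs) = if does (Any.any? (adj? G v) (greedy vs)) then greedy vs else v ∷ greedy vs

  greedy-independent : ∀ vs {u w} → u ∈ greedy vs → w ∈ greedy vs → ¬ Adj G u w
  greedy-independent (v ∷ vs) u∈ w∈ e with Any.any? (adj? G v) (greedy vs)
  ... | yes _ = greedy-independent vs u∈ w∈ e
  greedy-independent (v ∷ vs) (here refl) (here refl) e | no _  = irrefl G _ e
  greedy-independent (v ∷ vs) (here refl) (there w∈)  e | no ¬a = ¬a (Any.map (λ { refl → e }) w∈)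
  greedy-independent (v ∷ vs) (there u∈)  (here refl) e | no ¬a =
    ¬a (Any.map (λ { refl → adj-sym G e }) u∈)
  greedy-independent (v ∷ vs) (there u∈)  (there w∈)  e | no _  = greedy-independent vs u∈ w∈ e

  -- This is maximality: a vertex is rejected only because of a kept neighbour, and kept vertices
  -- are never dropped later.
  greedy-dominating : ∀ vs {u} → u ∈ vs → u ∈ greedy vs ⊎ ∃[ w ] (w ∈ greedy vs × Adj G u w)
  greedy-dominating (v ∷ vs) u∈ with Any.any? (adj? G v) (greedy vs)
  greedy-dominating (v ∷ vs) (here refl) | yes a =
    let (w , w∈ , e) = find a in inj₂ (w , w∈ , e)
  greedy-dominating (v ∷ vs) (there u∈)  | yes _ = greedy-dominating vs u∈
  greedy-dominating (v ∷ vs) (here refl) | no _ = inj₁ (here refl)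
  greedy-dominating (v ∷ vs) (there u∈)  | no _ with greedy-dominating vs u∈
  ... | inj₁ u∈S            = inj₁ (there u∈S)
  ... | inj₂ (w , w∈S , e) = inj₂ (w , there w∈S , e)

  -- Equivalently, the edges between the two sides form a spanning bipartite subgraph without
  -- isolated vertices.
  CrossNeighbours : (V G → Bool) → Set
  CrossNeighbours side = ∀ u → ∃[ w ] (Adj G u w × side w ≡ not (side u))

  -- Independence sends any neighbour of a vertex of `S` outside `S`; domination gives each vertex
  -- outside `S` a neighbour in `S`.
  crossing-partition : (∀ v → ∃[ w ] Adj G v w) → ∃ CrossNeighbours
  crossing-partition nbr = side , cross
    where
    vs = map (vertex G) (allFin (order G))
    S  = greedy vs

    _∈S? : U.Decidable (_∈ S)
    u ∈S? = Any.any? (_≟ⱽ_ G u) S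

    side : V G → Bool
    side u = does (u ∈S?)

    listed : ∀ u → u ∈ vs
    listed u = subst (_∈ _) (vertex∘index G u) (∈-map⁺ (vertex G) (∈-allFin (index G u)))

    cross : CrossNeighbours side
    cross u with u ∈S?
    ... | yes u∈S = let (w , e) = nbr u in
      w , e , dec-false (w ∈S?) λ w∈S → greedy-independent vs u∈S w∈S e
    ... | no u∉S with greedy-dominating vs (listed u)
    ...   | inj₁ u∈S           = ⊥-elim (u∉S u∈S)
    ...   | inj₂ (w , w∈S , e) = w , e , dec-true (w ∈S?) w∈S

-- The 3-colouring of the join

module _ (G H : Graph) (side : V G → Bool) where

  joinColour : Bool → ℕ
  joinColour b = if b then 1 else 2

  joinColour≢ : ∀ b {b′} → b′ ≡ not b → joinColour b ≢ joinColour b′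
  joinColour≢ true  refl ()
  joinColour≢ false refl ()

  joinColour≢0 : ∀ b → 0 ≢ joinColour b
  joinColour≢0 true  ()
  joinColour≢0 false ()

  joinColour<3 : ∀ b → joinColour b < 3
  joinColour<3 true  = s≤s (s≤s z≤n)
  joinColour<3 false = s≤s (s≤s (s≤s z≤n))

  threeColour : V (G ∨ᴳ H) → V (G ∨ᴳ H) → ℕ
  threeColour (inj₁ u) (inj₁ v) = 0
  threeColour (inj₁ u) (inj₂ v) = joinColour (side u)
  threeColour (inj₂ u) (inj₁ v) = joinColour (side v)
  threeColour (inj₂ u) (inj₂ v) = 0

  threeColour-sym : ∀ u v → threeColour u v ≡ threeColour v u
  threeColour-sym (inj₁ _) (inj₁ _) = refl
  threeColour-sym (inj₁ _) (inj₂ _) = refl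
  threeColour-sym (inj₂ _) (inj₁ _) = refl
  threeColour-sym (inj₂ _) (inj₂ _) = refl

  threeColour<3 : ∀ u v → threeColour u v < 3
  threeColour<3 (inj₁ _) (inj₁ _) = s≤s z≤n
  threeColour<3 (inj₁ u) (inj₂ _) = joinColour<3 (side u)
  threeColour<3 (inj₂ _) (inj₁ v) = joinColour<3 (side v)
  threeColour<3 (inj₂ _) (inj₂ _) = s≤s z≤n

  threeColouring : EdgeColouring (G ∨ᴳ H)
  threeColouring = symmetric-colouring (G ∨ᴳ H) threeColour threeColour-sym

  threeColouring-connected : V G → V H → CrossNeighbours G side →
                             Distance2ProperConnected threeColouring
  threeColouring-connected _ _ _ (inj₁ u) (inj₂ v) _ = linked₁ threeColouring tt
  threeColouring-connected _ _ _ (inj₂ u) (inj₁ v) _ = linked₁ threeColouring tt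
  threeColouring-connected g _ cross (inj₂ x) (inj₂ y) x≢y =
    -- Any vertex `g` of `G` serves: `g` and `g′` lie on different sides, so the two outer edges get
    -- colours 1 and 2 in some order.
    let (g′ , e , s) = cross g in
    linked₃ threeColouring {inj₂ x} {inj₁ g} {inj₁ g′} {inj₂ y} tt e tt
      (λ ()) (λ ()) x≢y
      (joinColour≢0 (side g) ∘ sym) (joinColour≢0 (side g′)) (joinColour≢ (side g) s)
  threeColouring-connected _ h cross (inj₁ u) (inj₁ v) u≢v with side v Bool.≟ side u
  ... | no  v≢u =
    linked₂ threeColouring {inj₁ u} {inj₂ h} {inj₁ v} tt tt u≢v
      (joinColour≢ (side u) (Bool.¬-not v≢u))
  ... | yes v≡u =
    let (u′ , e , s) = cross u
        s′ = trans s (cong not (sym v≡u)) in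
    linked₃ threeColouring {inj₁ u} {inj₁ u′} {inj₂ h} {inj₁ v} e tt tt
      (λ ())
      -- The detour vertex `u′` cannot be `v`, because it lies on the side opposite to `u`, which is
      -- also the side opposite to `v`.
      (λ eq → Bool.not-¬ refl (trans (cong side (sym (inj₁-injective eq))) s′))
      u≢v
      (joinColour≢0 (side u′)) (joinColour≢ (side v) s′ ∘ sym) (joinColour≢0 (side v))

-- The value for the join

theorem4p1 : (G H : Graph) → Nontrivial G → Nontrivial H →
    Connected G → Connected H →
    ∃[ k ] (IsPc₁,₂ (G ∨ᴳ H) k × k ≤ 3)
theorem4p1 G H G-nt H-nt G-conn H-conn =
  decide (complete? (G ∨ᴳ H)) (rainbowColourable? (G ∨ᴳ H))
  where
  g = a-vertex G G-nt
  h = a-vertex H H-nt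

  gh : Adj (G ∨ᴳ H) (inj₁ g) (inj₂ h)
  gh = tt

  decide : Dec (Complete (G ∨ᴳ H)) → Dec (RainbowColourable (G ∨ᴳ H)) →
           ∃[ k ] (IsPc₁,₂ (G ∨ᴳ H) k × k ≤ 3)
  decide (yes K) _       = 1 , complete⇒isPc₁ {u = inj₁ g} {inj₂ h} gh K , s≤s z≤n
  decide (no ¬K) (yes R) = 2 , rainbow⇒isPc₂ {u = inj₁ g} {inj₂ h} gh ¬K R , s≤s (s≤s z≤n)
  -- The failure of both earlier tests is the lower bound 3, and the colouring of the join attains
  -- it.
  decide (no ¬K) (no ¬R) =
    let (side , cross) = crossing-partition G (neighbour G G-nt G-conn) in
    3 ,
    isPc-intro (threeColouring G H side)
      (threeColouring-connected G H side g h cross)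
      (λ {u} {v} _ → threeColour<3 G H side u v)
      (λ c j conn → numColours≥3 c conn {inj₁ g} {inj₂ h} gh ¬K ¬R j) ,
    ≤-reflexive refl
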